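{- Let $G$ be a group with a gliding system $(\mathcal{G},\mathcal{I})$ such that there is an upper bound on the cardinality of sets of pairwise independent glides. Let $\mathcal{D}\subset G$ be an oriented regular set satisfying the square condition. Then for every $A\in\mathcal{D}$ the typing homomorphism $\mu_A:\pi_1(X_{\mathcal{D}},A)\to\mathcal{A}(G)$ is injective.
   Context: Gliding system $(\mathcal{G},\mathcal{I})$ in $G$: $\mathcal{G}\subset G\setminus\{1\}$ closed under inversion (glides), $\mathcal{I}\subset\mathcal{G}\times\mathcal{G}$ (independence) with $(s^{ -1},t),(t,s)\in\mathcal{I}$ and $st=ts\ne1$ whenever $(s,t)\in\mathcal{I}$. Pre-cubic set: finite set $S$ of pairwise independent glides, $[S]=\prod_{s\in S}s$; cubic: pre-cubic with $[T_1]\ne[T_2]$ for distinct $T_1,T_2\subset S$. Glide complex $X_G$: cubed complex with one $k$-cube for each equivalence class of based cubes $(A,S)$ ($A\in G$, $S$ cubic of size $k$) under $(A,S)\sim([T]A,(S\setminus T)\cup\{t^{ -1}:t\in T\})$; vertices $[T]A$, faces the cubes of $(A,S')$, $S'\subset S$; in particular 1-cells join $A$ and $sA$ for glides $s$. $X_{\mathcal{D}}$: subcomplex of cubes all of whose vertices lie in $\mathcal{D}$. $\mathcal{D}$ is regular if for every $A\in\mathcal{D}$ every pre-cubic $S$ with $sA\in\mathcal{D}$ ($s\in S$) and $stA\in\mathcal{D}$ (distinct $s,t\in S$) is cubic. Square condition: for $A\in\mathcal{D}$ and independent $s,t$ with $sA,tA\in\mathcal{D}$, $stA\in\mathcal{D}$.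 $\mathcal{A}(G)$ is the right-angled Artin group with generators $g_s$ ($s\in\mathcal{G}$) and relations $g_sg_t=g_tg_s$ for $(s,t)\in\mathcal{I}$. An orientation of $\mathcal{D}$ is a choice of direction of every 1-cell of $X_{\mathcal{D}}$ such that for every square with vertices $A,sA,tA,stA\in\mathcal{D}$ ($s,t$ independent), the 1-cells $A$–$sA$ and $tA$–$stA$ are either both directed towards $sA,stA$ or both towards $A,tA$ (and the same with $s,t$ exchanged); $\mathcal{D}$ is oriented if an orientation is fixed. For a 1-cell $e$ directed from $A$ to $B$ set $|e|=BA^{ -1}\in\mathcal{G}$. For an edge path $\alpha$ through consecutive 1-cells $e_1,\dots,e_n$, with $\nu_k=+1$ if the path traverses $e_k$ along its orientation and $-1$ otherwise, put $\mu(\alpha)=g_{|e_1|}^{\nu_1}\cdots g_{|e_n|}^{\nu_n}$; this is invariant under homotopy rel endpoints and defines the typing homomorphism $\mu_A:\pi_1(X_{\mathcal{D}},A)\to\mathcal{A}(G)$. -}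

module Defs where

open import Level using (Level; _⊔_; suc)
open import Algebra.Bundles using (Group)
open import Algebra.Morphism.Structures using (module GroupMorphisms)
import Algebra.Properties.Group as GroupProperties
open import Data.Bool.Base using (true; false; if_then_else_)
open import Data.Empty using (⊥-elim)
open import Data.Fin.Subset using (Subset)
open import Data.List.Base using (List; []; _∷_; _++_)
open import Data.List.Properties using (++-assoc; ++-identityʳ)
open import Data.List.Relation.Binary.Pointwise.Base using (Pointwise; []; _∷_)
open import Data.List.Relation.Binary.Pointwise using (++⁺) renaming (refl to pointwise-refl)
open import Data.Nat.Base using (ℕ; _≤_)
open import Data.Product.Base using (Σ; ∃; _×_; _,_; proj₁; proj₂)
open import Data.Sign.Base using (Sign; +; -; opposite)
open import Data.Sum.Base using (_⊎_; inj₁; inj₂)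
open import Data.Vec.Base using (Vec; []; _∷_; head; lookup; zipWith)
import Data.Vec.Membership.Setoid as Membership
open import Data.Vec.Relation.Unary.All using (All; []; _∷_)
open import Data.Vec.Relation.Unary.AllPairs using (AllPairs; []; _∷_)
open import Data.Vec.Relation.Unary.Any using (here)
open import Function.Bundles using (_⇔_; mk⇔; Equivalence)
open import Relation.Binary.Core using (Rel)
open import Relation.Binary.Construct.Closure.Equivalence as EqClosure using (EqClosure)
open import Relation.Binary.Definitions using (_Respects_; _Respects₂_)
open import Relation.Binary.PropositionalEquality as ≡ using (_≡_; _≢_)
import Relation.Binary.Reasoning.Setoid as SetoidReasoning
open import Relation.Nullary using (¬_)
open import Relation.Unary using (Pred)

record GlidingSystem {c ℓ} (G : Group c ℓ) (g i : Level) : Set (c ⊔ ℓ ⊔ suc (g ⊔ i)) where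
  open Group G
  field
    Glide       : Pred Carrier g
    glide-resp  : Glide Respects _≈_
    glide≉ε     : ∀ {s} → Glide s → ¬ (s ≈ ε)
    glide-⁻¹    : ∀ {s} → Glide s → Glide (s ⁻¹)

    Indep       : Rel Carrier i
    indep-resp  : Indep Respects₂ _≈_
    indep-glide : ∀ {s t} → Indep s t → Glide s × Glide t
    indep-⁻¹    : ∀ {s t} → Indep s t → Indep (s ⁻¹) t
    indep-sym   : ∀ {s t} → Indep s t → Indep t s
    indep-comm  : ∀ {s t} → Indep s t → s ∙ t ≈ t ∙ s
    indep≉ε     : ∀ {s t} → Indep s t → ¬ (s ∙ t ≈ ε)

record SubsetOf {c ℓ} (G : Group c ℓ) (d : Level) : Set (c ⊔ ℓ ⊔ suc d) where
  open Group G
  field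
    Member : Pred Carrier d
    resp   : Member Respects _≈_

module Cubes {c ℓ g i} {G : Group c ℓ} (𝒮 : GlidingSystem G g i) where
  open Group G
  open GroupProperties G
  open GlidingSystem 𝒮
  open Membership setoid using (_∈_)

  prod : ∀ {k} → Subset k → Vec Carrier k → Carrier
  prod []          []      = ε
  prod (true ∷ T)  (s ∷ S) = s ∙ prod T S
  prod (false ∷ T) (s ∷ S) = prod T S

  -- (S ∖ T) ∪ { t⁻¹ : t ∈ T }
  invertOn : ∀ {k} → Subset k → Vec Carrier k → Vec Carrier k
  invertOn = zipWith (λ inT s → if inT then s ⁻¹ else s)

  -- Finite sets of glides are enumerated by vectors; this is equality of the
  -- underlying sets.
  _≑_ : ∀ {k} → Rel (Vec Carrier k) (c ⊔ ℓ)
  S ≑ S′ = ∀ x → x ∈ S ⇔ x ∈ S′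

  -- No glide is independent of itself (see indep⇒≉), so such an enumeration has
  -- no repetitions and k is the cardinality of the set.
  record PreCubic {k} (S : Vec Carrier k) : Set (c ⊔ g ⊔ i) where
    constructor preCubic
    field
      glides : All Glide S
      indep  : AllPairs Indep S

  record Cubic {k} (S : Vec Carrier k) : Set (c ⊔ ℓ ⊔ g ⊔ i) where
    constructor cubic
    field
      isPreCubic : PreCubic S
      separated  : ∀ (T₁ T₂ : Subset k) → T₁ ≢ T₂ → ¬ (prod T₁ S ≈ prod T₂ S)

  Bounded : Set (c ⊔ g ⊔ i)
  Bounded = ∃ λ (N : ℕ) → ∀ {k} (S : Vec Carrier k) → PreCubic S → k ≤ N

  indep⇒≉ : ∀ {s t} → Indep s t → ¬ (s ≈ t)
  indep⇒≉ {s} {t} p s≈t = indep≉ε (indep-⁻¹ p) (trans (∙-congˡ (sym s≈t)) (inverseˡ s))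

  cubic₁ : ∀ {s} → Glide s → Cubic (s ∷ [])
  cubic₁ {s} p = cubic (preCubic (p ∷ []) ([] ∷ [])) sep
    where
    sep : ∀ T₁ T₂ → T₁ ≢ T₂ → ¬ (prod T₁ (s ∷ []) ≈ prod T₂ (s ∷ []))
    sep (true ∷ [])  (true ∷ [])  ne _  = ne ≡.refl
    sep (true ∷ [])  (false ∷ []) _  eq = glide≉ε p (trans (sym (identityʳ s)) eq)
    sep (false ∷ []) (true ∷ [])  _  eq = glide≉ε p (trans (sym (identityʳ s)) (sym eq))
    sep (false ∷ []) (false ∷ []) ne _  = ne ≡.refl

  cubic₂ : ∀ {s t} → Indep s t → Cubic (s ∷ t ∷ [])
  cubic₂ {s} {t} p = cubic (preCubic (ps ∷ pt ∷ []) ((p ∷ []) ∷ [] ∷ [])) sep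
    where
    ps = proj₁ (indep-glide p)
    pt = proj₂ (indep-glide p)
    S = s ∷ t ∷ []
    s≉ : ¬ (s ∙ ε ≈ ε)
    s≉ eq = glide≉ε ps (trans (sym (identityʳ s)) eq)
    t≉ : ¬ (t ∙ ε ≈ ε)
    t≉ eq = glide≉ε pt (trans (sym (identityʳ t)) eq)
    st≉ : ¬ (s ∙ (t ∙ ε) ≈ ε)
    st≉ eq = indep≉ε p (trans (∙-congˡ (sym (identityʳ t))) eq)
    s≉t : ¬ (s ∙ ε ≈ t ∙ ε)
    s≉t eq = indep⇒≉ p (∙-cancelʳ ε s t eq)
    st≉s : ¬ (s ∙ (t ∙ ε) ≈ s ∙ ε)
    st≉s eq = t≉ (∙-cancelˡ s (t ∙ ε) ε eq)
    st≉t : ¬ (s ∙ (t ∙ ε) ≈ t ∙ ε)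
    st≉t eq = s≉ (trans (identityʳ s) (identityˡ-unique s (t ∙ ε) eq))
    sep : ∀ T₁ T₂ → T₁ ≢ T₂ → ¬ (prod T₁ S ≈ prod T₂ S)
    sep (true ∷ true ∷ [])   (true ∷ true ∷ [])   ne _  = ne ≡.refl
    sep (true ∷ true ∷ [])   (true ∷ false ∷ [])  _  eq = st≉s eq
    sep (true ∷ true ∷ [])   (false ∷ true ∷ [])  _  eq = st≉t eq
    sep (true ∷ true ∷ [])   (false ∷ false ∷ []) _  eq = st≉ eq
    sep (true ∷ false ∷ [])  (true ∷ true ∷ [])   _  eq = st≉s (sym eq)
    sep (true ∷ false ∷ [])  (true ∷ false ∷ [])  ne _  = ne ≡.refl
    sep (true ∷ false ∷ [])  (false ∷ true ∷ [])  _  eq = s≉t eq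
    sep (true ∷ false ∷ [])  (false ∷ false ∷ []) _  eq = s≉ eq
    sep (false ∷ true ∷ [])  (true ∷ true ∷ [])   _  eq = st≉t (sym eq)
    sep (false ∷ true ∷ [])  (true ∷ false ∷ [])  _  eq = s≉t (sym eq)
    sep (false ∷ true ∷ [])  (false ∷ true ∷ [])  ne _  = ne ≡.refl
    sep (false ∷ true ∷ [])  (false ∷ false ∷ []) _  eq = t≉ eq
    sep (false ∷ false ∷ []) (true ∷ true ∷ [])   _  eq = st≉ (sym eq)
    sep (false ∷ false ∷ []) (true ∷ false ∷ [])  _  eq = s≉ (sym eq)
    sep (false ∷ false ∷ []) (false ∷ true ∷ [])  _  eq = t≉ (sym eq)
    sep (false ∷ false ∷ []) (false ∷ false ∷ []) ne _  = ne ≡.refl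

module Artin {c ℓ g i} {G : Group c ℓ} (𝒮 : GlidingSystem G g i) where
  open Group G using (Carrier) renaming (_≈_ to _≈ᴳ_)
  open GlidingSystem 𝒮

  infixl 7 _∙_
  infix  8 _⁻¹
  infix  4 _≈_

  data Word : Set (c ⊔ g) where
    gen : ∀ s → Glide s → Word
    ε   : Word
    _∙_ : Word → Word → Word
    _⁻¹ : Word → Word

  data _≈_ : Word → Word → Set (c ⊔ ℓ ⊔ g ⊔ i) where
    refl      : ∀ {x} → x ≈ x
    sym       : ∀ {x y} → x ≈ y → y ≈ x
    trans     : ∀ {x y z} → x ≈ y → y ≈ z → x ≈ z
    ∙-cong    : ∀ {x x′ y y′} → x ≈ x′ → y ≈ y′ → x ∙ y ≈ x′ ∙ y′
    ⁻¹-cong   : ∀ {x y} → x ≈ y → x ⁻¹ ≈ y ⁻¹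
    assoc     : ∀ x y z → x ∙ y ∙ z ≈ x ∙ (y ∙ z)
    identityˡ : ∀ x → ε ∙ x ≈ x
    identityʳ : ∀ x → x ∙ ε ≈ x
    inverseˡ  : ∀ x → x ⁻¹ ∙ x ≈ ε
    inverseʳ  : ∀ x → x ∙ x ⁻¹ ≈ ε
    gen-cong  : ∀ {s t} (p : Glide s) (q : Glide t) → s ≈ᴳ t → gen s p ≈ gen t q
    gen-comm  : ∀ {s t} (p : Glide s) (q : Glide t) → Indep s t →
                gen s p ∙ gen t q ≈ gen t q ∙ gen s p

  artinGroup : Group (c ⊔ g) (c ⊔ ℓ ⊔ g ⊔ i)
  artinGroup = record
    { Carrier = Word
    ; _≈_     = _≈_
    ; _∙_     = _∙_
    ; ε       = ε
    ; _⁻¹     = _⁻¹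
    ; isGroup = record
      { isMonoid = record
        { isSemigroup = record
          { isMagma = record
            { isEquivalence = record { refl = refl ; sym = sym ; trans = trans }
            ; ∙-cong        = ∙-cong
            }
          ; assoc = assoc
          }
        ; identity = identityˡ , identityʳ
        }
      ; inverse = inverseˡ , inverseʳ
      ; ⁻¹-cong = ⁻¹-cong
      }
    }

module SignedPower {c ℓ} (G : Group c ℓ) where
  open Group G
  open SetoidReasoning setoid

  infix 8 _^_
  _^_ : Carrier → Sign → Carrier
  x ^ + = x
  x ^ - = x ⁻¹

  ^-cong : ∀ {x y} σ → x ≈ y → x ^ σ ≈ y ^ σ
  ^-cong + eq = eq
  ^-cong - eq = ⁻¹-cong eq

  ^-opposite : ∀ x σ → x ^ σ ∙ x ^ opposite σ ≈ ε
  ^-opposite x + = inverseʳ x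
  ^-opposite x - = inverseˡ x

  ⁻¹-commutes : ∀ {x y} → x ∙ y ≈ y ∙ x → x ⁻¹ ∙ y ≈ y ∙ x ⁻¹
  ⁻¹-commutes {x} {y} eq = begin
    x ⁻¹ ∙ y                ≈⟨ ∙-congˡ (identityʳ y) ⟨
    x ⁻¹ ∙ (y ∙ ε)          ≈⟨ ∙-congˡ (∙-congˡ (inverseʳ x)) ⟨
    x ⁻¹ ∙ (y ∙ (x ∙ x ⁻¹)) ≈⟨ ∙-congˡ (assoc y x (x ⁻¹)) ⟨
    x ⁻¹ ∙ (y ∙ x ∙ x ⁻¹)   ≈⟨ ∙-congˡ (∙-congʳ eq) ⟨
    x ⁻¹ ∙ (x ∙ y ∙ x ⁻¹)   ≈⟨ ∙-congˡ (assoc x y (x ⁻¹)) ⟩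
    x ⁻¹ ∙ (x ∙ (y ∙ x ⁻¹)) ≈⟨ assoc (x ⁻¹) x (y ∙ x ⁻¹) ⟨
    x ⁻¹ ∙ x ∙ (y ∙ x ⁻¹)   ≈⟨ ∙-congʳ (inverseˡ x) ⟩
    ε ∙ (y ∙ x ⁻¹)          ≈⟨ identityˡ _ ⟩
    y ∙ x ⁻¹                ∎

  ^-commutesˡ : ∀ {x y} σ → x ∙ y ≈ y ∙ x → x ^ σ ∙ y ≈ y ∙ x ^ σ
  ^-commutesˡ + eq = eq
  ^-commutesˡ - eq = ⁻¹-commutes eq

  ^-commutes : ∀ {x y} σ τ → x ∙ y ≈ y ∙ x → x ^ σ ∙ y ^ τ ≈ y ^ τ ∙ x ^ σ
  ^-commutes σ τ eq = ^-commutesˡ σ (sym (^-commutesˡ τ (sym eq)))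

module GlideComplex {c ℓ g i d} {G : Group c ℓ} (𝒮 : GlidingSystem G g i) (𝒟 : SubsetOf G d) where
  open Group G
  open GroupProperties G
  open GlidingSystem 𝒮
  open SubsetOf 𝒟 renaming (Member to D; resp to D-resp)
  open Cubes 𝒮
  open SetoidReasoning setoid
  open SignedPower G using (_^_)

  Regular : Set (c ⊔ ℓ ⊔ g ⊔ i ⊔ d)
  Regular = ∀ A → D A → ∀ {k} (S : Vec Carrier k) → PreCubic S →
            (∀ p → D (lookup S p ∙ A)) →
            (∀ p q → p ≢ q → D (lookup S p ∙ lookup S q ∙ A)) →
            Cubic S

  SquareCondition : Set (c ⊔ i ⊔ d)
  SquareCondition = ∀ A s t → D A → Indep s t → D (s ∙ A) → D (t ∙ A) → D (s ∙ t ∙ A)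

  record BasedCube (k : ℕ) : Set (c ⊔ ℓ ⊔ g ⊔ i ⊔ d) where
    constructor basedCube
    field
      base     : Carrier
      glides   : Vec Carrier k
      isCubic  : Cubic glides
      vertices : ∀ T → D (prod T glides ∙ base)
  open BasedCube public

  -- The k-cells of X_D are the ∼-classes of based k-cubes.  In particular a based
  -- 1-cube (A , {s}) is a 1-cell together with a direction of travel, from A to s ∙ A.
  infix 4 _∼_
  _∼_ : ∀ {k} → Rel (BasedCube k) (c ⊔ ℓ)
  _∼_ {k} x y = Σ (Subset k) λ T →
    base y ≈ prod T (glides x) ∙ base x × glides y ≑ invertOn T (glides x)

  glide : BasedCube 1 → Carrier
  glide e = head (glides e)

  end : BasedCube 1 → Carrier
  end e = glide e ∙ base e

  edge : ∀ A s → Glide s → D A → D (s ∙ A) → BasedCube 1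
  edge A s p a b = basedCube A (s ∷ []) (cubic₁ p) λ where
    (true ∷ [])  → D-resp (∙-congʳ (sym (identityʳ s))) b
    (false ∷ []) → D-resp (sym (identityˡ A)) a

  -- The sides of the square (A , {s , t}):
  -- bottom : A → sA,  right : sA → tsA,  left : A → tA,  top : tA → stA.
  bottom right left top : BasedCube 2 → BasedCube 1
  bottom (basedCube A (s ∷ t ∷ []) (cubic (preCubic (ps ∷ pt ∷ []) _) _) v) =
    edge A s ps
      (D-resp (identityˡ A) (v (false ∷ false ∷ [])))
      (D-resp (∙-congʳ (identityʳ s)) (v (true ∷ false ∷ [])))
  right (basedCube A (s ∷ t ∷ []) (cubic (preCubic (ps ∷ pt ∷ []) ((st ∷ []) ∷ _)) _) v) =
    edge (s ∙ A) t pt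
      (D-resp (∙-congʳ (identityʳ s)) (v (true ∷ false ∷ [])))
      (D-resp (trans (∙-congʳ (trans (∙-congˡ (identityʳ t)) (indep-comm st))) (assoc t s A))
        (v (true ∷ true ∷ [])))
  left (basedCube A (s ∷ t ∷ []) (cubic (preCubic (ps ∷ pt ∷ []) _) _) v) =
    edge A t pt
      (D-resp (identityˡ A) (v (false ∷ false ∷ [])))
      (D-resp (∙-congʳ (identityʳ t)) (v (false ∷ true ∷ [])))
  top (basedCube A (s ∷ t ∷ []) (cubic (preCubic (ps ∷ pt ∷ []) _) _) v) =
    edge (t ∙ A) s ps
      (D-resp (∙-congʳ (identityʳ t)) (v (false ∷ true ∷ [])))
      (D-resp (trans (∙-congʳ (∙-congˡ (identityʳ t))) (assoc s t A)) (v (true ∷ true ∷ [])))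

  -- A direction of every 1-cell: dir (A , {s}) is + if the cell is directed from A to
  -- s ∙ A, and - if from s ∙ A to A.  It depends only on the cell and the
  -- direction of travel.
  record Orientation : Set (c ⊔ ℓ ⊔ g ⊔ i ⊔ d) where
    field
      dir          : BasedCube 1 → Sign
      dir-same     : ∀ e f → e ∼ f → base f ≈ base e → dir f ≡ dir e
      dir-opposite : ∀ e f → e ∼ f → base f ≈ end e → dir f ≡ opposite (dir e)
      bottom-top   : ∀ q → dir (bottom q) ≡ dir (top q)
      left-right   : ∀ q → dir (left q) ≡ dir (right q)

  Chain : Carrier → List (BasedCube 1) → Carrier → Set ℓ
  Chain A []       B = A ≈ B
  Chain A (e ∷ es) B = A ≈ base e × Chain (end e) es B

  record Path (A B : Carrier) : Set (c ⊔ ℓ ⊔ g ⊔ i ⊔ d) where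
    constructor path
    field
      edges : List (BasedCube 1)
      chain : Chain A edges B
  open Path public

  -- Elementary homotopies of edge paths.  They are only ever applied to two edge paths
  -- with common endpoints; so in respell the paths traverse the same 1-cells from the same
  -- vertices, and in backtrack the 1-cell of e is traversed back and forth.
  infix 4 _⇝_
  data _⇝_ : Rel (List (BasedCube 1)) (c ⊔ ℓ ⊔ g ⊔ i ⊔ d) where
    respell   : ∀ {es fs} → Pointwise _∼_ es fs → es ⇝ fs
    backtrack : ∀ {e f} es → e ∼ f → e ∷ f ∷ es ⇝ es
    slide     : ∀ q es → bottom q ∷ right q ∷ es ⇝ left q ∷ top q ∷ es
    _∷_       : ∀ e {es fs} → es ⇝ fs → e ∷ es ⇝ e ∷ fs

  infix 4 _≃_
  _≃_ : ∀ {A B} → Rel (Path A B) (c ⊔ ℓ ⊔ g ⊔ i ⊔ d)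
  _≃_ = EqClosure (λ p q → edges p ⇝ edges q)

  ∼-split : ∀ e f → e ∼ f →
    (base f ≈ base e × glide f ≈ glide e) ⊎ (base f ≈ end e × glide f ≈ glide e ⁻¹)
  ∼-split (basedCube A (s ∷ []) _ _) (basedCube B (t ∷ []) _ _) (false ∷ [] , p , q)
    with here r ← Equivalence.to (q t) (here refl) = inj₁ (trans p (identityˡ A) , r)
  ∼-split (basedCube A (s ∷ []) _ _) (basedCube B (t ∷ []) _ _) (true ∷ [] , p , q)
    with here r ← Equivalence.to (q t) (here refl) = inj₂ (trans p (∙-congʳ (identityʳ s)) , r)

  singleton-≑ : ∀ {s t} → s ≈ t → (s ∷ []) ≑ (t ∷ [])
  singleton-≑ eq x = mk⇔ (λ { (here p) → here (trans p eq) })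
                         (λ { (here p) → here (trans p (sym eq)) })

  ∼-same : ∀ e f → base f ≈ base e → glide f ≈ glide e → e ∼ f
  ∼-same (basedCube A (s ∷ []) _ _) (basedCube B (t ∷ []) _ _) p q =
    false ∷ [] , trans p (sym (identityˡ A)) , singleton-≑ q

  ∼-opposite : ∀ e f → base f ≈ end e → glide f ≈ glide e ⁻¹ → e ∼ f
  ∼-opposite (basedCube A (s ∷ []) _ _) (basedCube B (t ∷ []) _ _) p q =
    true ∷ [] , trans p (∙-congʳ (sym (identityʳ s))) , singleton-≑ q

  glide-Glide : ∀ e → Glide (glide e)
  glide-Glide (basedCube A (s ∷ []) (cubic (preCubic (p ∷ []) _) _) _) = p

  base∈D : ∀ (e : BasedCube 1) → D (base e)
  base∈D (basedCube A (s ∷ []) _ v) = D-resp (identityˡ A) (v (false ∷ []))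

  end∈D : ∀ e → D (end e)
  end∈D (basedCube A (s ∷ []) _ v) = D-resp (∙-congʳ (identityʳ s)) (v (true ∷ []))

  end≉base : ∀ e → ¬ (end e ≈ base e)
  end≉base e eq = glide≉ε (glide-Glide e) (identityˡ-unique (glide e) (base e) eq)

  same-glide : ∀ e f → e ∼ f → base f ≈ base e → glide f ≈ glide e
  same-glide e f e∼f eq with ∼-split e f e∼f
  ... | inj₁ (_ , q) = q
  ... | inj₂ (p , _) = ⊥-elim (end≉base e (trans (sym p) eq))

  opposite-glide : ∀ e f → e ∼ f → base f ≈ end e → glide f ≈ glide e ⁻¹
  opposite-glide e f e∼f eq with ∼-split e f e∼f
  ... | inj₁ (p , _) = ⊥-elim (end≉base e (trans (sym eq) p))
  ... | inj₂ (_ , q) = q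

  opposite-end : ∀ e {B t} → B ≈ end e → t ≈ glide e ⁻¹ → t ∙ B ≈ base e
  opposite-end e p q = trans (∙-cong q p) (\\-leftDividesʳ (glide e) (base e))

  ∼-sym : ∀ e f → e ∼ f → f ∼ e
  ∼-sym e f e∼f with ∼-split e f e∼f
  ... | inj₁ (p , q) = ∼-same f e (sym p) (sym q)
  ... | inj₂ (p , q) = ∼-opposite f e (sym (opposite-end e p q))
                         (trans (sym (⁻¹-involutive (glide e))) (⁻¹-cong (sym q)))

  ∼-trans : ∀ e f h → e ∼ f → f ∼ h → e ∼ h
  ∼-trans e f h e∼f f∼h with ∼-split e f e∼f | ∼-split f h f∼h
  ... | inj₁ (p , q) | inj₁ (p′ , q′) = ∼-same e h (trans p′ p) (trans q′ q)
  ... | inj₁ (p , q) | inj₂ (p′ , q′) =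
    ∼-opposite e h (trans p′ (∙-cong q p)) (trans q′ (⁻¹-cong q))
  ... | inj₂ (p , q) | inj₁ (p′ , q′) = ∼-opposite e h (trans p′ p) (trans q′ q)
  ... | inj₂ (p , q) | inj₂ (p′ , q′) =
    ∼-same e h (trans p′ (opposite-end e p q))
      (trans q′ (trans (⁻¹-cong q) (⁻¹-involutive (glide e))))

  ∼-refl : ∀ e → e ∼ e
  ∼-refl e = ∼-same e e refl refl

  flip : BasedCube 1 → BasedCube 1
  flip e = edge (end e) (glide e ⁻¹) (glide-⁻¹ (glide-Glide e)) (end∈D e)
    (D-resp (sym (opposite-end e refl refl)) (base∈D e))

  flip-∼ : ∀ e → e ∼ flip e
  flip-∼ e = ∼-opposite e (flip e) refl refl

  flip-end : ∀ e → end (flip e) ≈ base e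
  flip-end e = opposite-end e refl refl

  flip-cong : ∀ e f → e ∼ f → flip e ∼ flip f
  flip-cong e f e∼f = ∼-trans (flip e) e (flip f) (∼-sym e (flip e) (flip-∼ e))
    (∼-trans e f (flip f) e∼f (flip-∼ f))

  chain-resp : ∀ {A A′ B} es → A ≈ A′ → Chain A′ es B → Chain A es B
  chain-resp []       eq p       = trans eq p
  chain-resp (e ∷ es) eq (p , q) = trans eq p , q

  chain-++ : ∀ {A B C} es {fs} → Chain A es B → Chain B fs C → Chain A (es ++ fs) C
  chain-++ []       {fs} p       q = chain-resp fs p q
  chain-++ (e ∷ es)      (p , r) q = p , chain-++ es r q

  nil : ∀ {A} → Path A A
  nil = path [] refl

  infixl 7 _·_
  _·_ : ∀ {A B C} → Path A B → Path B C → Path A C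
  p · q = path (edges p ++ edges q) (chain-++ (edges p) (chain p) (chain q))

  reverseEdges : List (BasedCube 1) → List (BasedCube 1)
  reverseEdges []       = []
  reverseEdges (e ∷ es) = reverseEdges es ++ (flip e ∷ [])

  chain-reverse : ∀ {A B} es → Chain A es B → Chain B (reverseEdges es) A
  chain-reverse []       p       = sym p
  chain-reverse (e ∷ es) (p , q) =
    chain-++ (reverseEdges es) (chain-reverse es q) (refl , trans (flip-end e) (sym p))

  reverse : ∀ {A B} → Path A B → Path B A
  reverse p = path (reverseEdges (edges p)) (chain-reverse (edges p) (chain p))

  module _ {A B : Carrier} where
    private R = λ (p q : Path A B) → edges p ⇝ edges q

    ≃-refl : ∀ {p} → p ≃ p
    ≃-refl = EqClosure.reflexive R
    ≃-sym : ∀ {p q} → p ≃ q → q ≃ p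
    ≃-sym = EqClosure.symmetric R
    ≃-trans : ∀ {p q r} → p ≃ q → q ≃ r → p ≃ r
    ≃-trans = EqClosure.transitive R
    move : ∀ {p q} → edges p ⇝ edges q → p ≃ q
    move = EqClosure.return {R = R}

  respell-refl : ∀ es → Pointwise _∼_ es es
  respell-refl es = pointwise-refl (λ {e} → ∼-refl e)

  edges≡ : ∀ {A B} (p q : Path A B) → edges p ≡ edges q → p ≃ q
  edges≡ p q eq = move (≡.subst (edges p ⇝_) eq (respell (respell-refl (edges p))))

  ⇝-++ʳ : ∀ {es fs} hs → es ⇝ fs → es ++ hs ⇝ fs ++ hs
  ⇝-++ʳ hs (respell r)      = respell (++⁺ r (respell-refl hs))
  ⇝-++ʳ hs (backtrack es r) = backtrack (es ++ hs) r
  ⇝-++ʳ hs (slide q es)     = slide q (es ++ hs)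
  ⇝-++ʳ hs (e ∷ m)          = e ∷ ⇝-++ʳ hs m

  ⇝-++ˡ : ∀ hs {es fs} → es ⇝ fs → hs ++ es ⇝ hs ++ fs
  ⇝-++ˡ []       m = m
  ⇝-++ˡ (h ∷ hs) m = h ∷ ⇝-++ˡ hs m

  ·-cong : ∀ {A B C} {p p′ : Path A B} {q q′ : Path B C} → p ≃ p′ → q ≃ q′ → p · q ≃ p′ · q′
  ·-cong {p′ = p′} {q = q} p≃p′ q≃q′ =
    ≃-trans (EqClosure.gmap (_· q) (⇝-++ʳ (edges q)) p≃p′)
            (EqClosure.gmap (p′ ·_) (⇝-++ˡ (edges p′)) q≃q′)

  ·-assoc : ∀ {A B C E} (p : Path A B) (q : Path B C) (r : Path C E) → p · q · r ≃ p · (q · r)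
  ·-assoc p q r = edges≡ (p · q · r) (p · (q · r)) (++-assoc (edges p) (edges q) (edges r))

  ·-identityˡ : ∀ {A B} (p : Path A B) → nil · p ≃ p
  ·-identityˡ p = edges≡ (nil · p) p ≡.refl

  ·-identityʳ : ∀ {A B} (p : Path A B) → p · nil ≃ p
  ·-identityʳ p = edges≡ (p · nil) p (++-identityʳ (edges p))

  step : ∀ {A} e → A ≈ base e → Path A (end e)
  step e p = path (e ∷ []) (p , refl)

  chain-inverseʳ : ∀ {A B} es (c : Chain A es B) → path es c · reverse (path es c) ≃ nil
  chain-inverseʳ []           c       = edges≡ _ _ ≡.refl
  chain-inverseʳ {A} (e ∷ es) (a , c) =
    ≃-trans (edges≡ (path (e ∷ es) (a , c) · reverse (path (e ∷ es) (a , c)))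
                    (P · (Q · reverse Q · reverse P))
                    (≡.cong (e ∷_) (≡.sym (++-assoc es (reverseEdges es) (flip e ∷ [])))))
    (≃-trans (·-cong {p = P} ≃-refl (·-cong {q = reverse P} (chain-inverseʳ es c) ≃-refl))
             (move (backtrack [] (flip-∼ e))))
    where
    P = step {A} e a
    Q = path es c

  chain-inverseˡ : ∀ {A B} es (c : Chain A es B) → reverse (path es c) · path es c ≃ nil
  chain-inverseˡ []           c       = edges≡ _ _ ≡.refl
  chain-inverseˡ {A} (e ∷ es) (a , c) =
    ≃-trans (edges≡ (reverse (path (e ∷ es) (a , c)) · path (e ∷ es) (a , c))
                    (reverse Q · (reverse P · P · Q))
                    (++-assoc (reverseEdges es) (flip e ∷ []) (e ∷ es)))
    (≃-trans (·-cong {p = reverse Q} ≃-refl (·-cong {q = Q} reverseP·P≃nil ≃-refl))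
    (≃-trans (·-cong {p = reverse Q} ≃-refl (·-identityˡ Q)) (chain-inverseˡ es c)))
    where
    P = step {A} e a
    Q = path es c
    reverseP·P≃nil : reverse P · P ≃ nil
    reverseP·P≃nil = move (backtrack [] (∼-sym e (flip e) (flip-∼ e)))

  ·-inverseʳ : ∀ {A B} (p : Path A B) → p · reverse p ≃ nil
  ·-inverseʳ p = chain-inverseʳ (edges p) (chain p)

  ·-inverseˡ : ∀ {A B} (p : Path A B) → reverse p · p ≃ nil
  ·-inverseˡ p = chain-inverseˡ (edges p) (chain p)

  -- Inverses are unique in the groupoid of edge paths, so reversal preserves homotopy.
  reverse-cong : ∀ {A B} {p q : Path A B} → p ≃ q → reverse p ≃ reverse q
  reverse-cong {p = p} {q} p≃q =
    ≃-trans (≃-sym (·-identityʳ (reverse p)))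
    (≃-trans (·-cong {p = reverse p} ≃-refl (≃-sym (·-inverseʳ q)))
    (≃-trans (≃-sym (·-assoc (reverse p) q (reverse q)))
    (≃-trans (·-cong {q = reverse q} (·-cong {p = reverse p} ≃-refl (≃-sym p≃q)) ≃-refl)
    (≃-trans (·-cong {q = reverse q} (·-inverseˡ p) ≃-refl)
             (·-identityˡ (reverse q))))))

  -- The fundamental group of X_D at A in its combinatorial form, the edge-path group:
  -- edge loops at A modulo backtracking and sliding across the squares of X_D.
  π₁ : Carrier → Group (c ⊔ ℓ ⊔ g ⊔ i ⊔ d) (c ⊔ ℓ ⊔ g ⊔ i ⊔ d)
  π₁ A = record
    { Carrier = Path A A
    ; _≈_     = _≃_
    ; _∙_     = _·_
    ; ε       = nil
    ; _⁻¹     = reverse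
    ; isGroup = record
      { isMonoid = record
        { isSemigroup = record
          { isMagma = record
            { isEquivalence = record { refl = ≃-refl ; sym = ≃-sym ; trans = ≃-trans }
            ; ∙-cong        = ·-cong
            }
          ; assoc = ·-assoc
          }
        ; identity = ·-identityˡ , ·-identityʳ
        }
      ; inverse = ·-inverseˡ , ·-inverseʳ
      ; ⁻¹-cong = reverse-cong
      }
    }

  module Typing (o : Orientation) where
    open Orientation o
    private
      module 𝒜 = Group (Artin.artinGroup 𝒮)
      module 𝒜ᵖ = GroupProperties (Artin.artinGroup 𝒮)
      module ^𝒜 = SignedPower (Artin.artinGroup 𝒮)
      module ^G = SignedPower G
    open Artin 𝒮 using (Word; gen; gen-cong; gen-comm)

    source target ∣_∣ : BasedCube 1 → Carrier
    source e with dir e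
    ... | + = base e
    ... | - = end e
    target e with dir e
    ... | + = end e
    ... | - = base e
    ∣ e ∣ = target e ∙ source e ⁻¹

    ∣∣≈ : ∀ e → ∣ e ∣ ≈ glide e ^ dir e
    ∣∣≈ e with dir e
    ... | + = //-rightDividesʳ (base e) (glide e)
    ... | - = begin
      base e ∙ (glide e ∙ base e) ⁻¹       ≈⟨ ∙-congˡ (⁻¹-anti-homo-∙ (glide e) (base e)) ⟩
      base e ∙ (base e ⁻¹ ∙ glide e ⁻¹)    ≈⟨ \\-leftDividesˡ (base e) (glide e ⁻¹) ⟩
      glide e ⁻¹                           ∎

    ^-Glide : ∀ {s} σ → Glide s → Glide (s ^ σ)
    ^-Glide + p = p
    ^-Glide - p = glide-⁻¹ p

    ^-Indep : ∀ {s t} σ τ → Indep s t → Indep (s ^ σ) (t ^ τ)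
    ^-Indep + + p = p
    ^-Indep + - p = indep-sym (indep-⁻¹ (indep-sym p))
    ^-Indep - + p = indep-⁻¹ p
    ^-Indep - - p = indep-⁻¹ (indep-sym (indep-⁻¹ (indep-sym p)))

    ∣∣-Glide : ∀ e → Glide ∣ e ∣
    ∣∣-Glide e = glide-resp (sym (∣∣≈ e)) (^-Glide (dir e) (glide-Glide e))

    letter : BasedCube 1 → Word
    letter e = gen ∣ e ∣ (∣∣-Glide e) ^𝒜.^ dir e

    word : List (BasedCube 1) → Word
    word []       = 𝒜.ε
    word (e ∷ es) = letter e 𝒜.∙ word es

    μ : ∀ {A} → Path A A → Word
    μ p = word (edges p)

    letter-cong : ∀ e f → dir e ≡ dir f → glide e ≈ glide f → letter e 𝒜.≈ letter f
    letter-cong e f p q = 𝒜.trans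
      (^𝒜.^-cong (dir e) (gen-cong _ _ (trans (∣∣≈ e) (trans (^G.^-cong (dir e) q)
        (trans (reflexive (≡.cong (glide f ^_) p)) (sym (∣∣≈ f)))))))
      (𝒜.reflexive (≡.cong (gen ∣ f ∣ (∣∣-Glide f) ^𝒜.^_) p))

    letter-backtrack : ∀ e f → e ∼ f → base f ≈ end e → letter e 𝒜.∙ letter f 𝒜.≈ 𝒜.ε
    letter-backtrack e f e∼f p = 𝒜.trans
      (𝒜.∙-congˡ (𝒜.trans
        (^𝒜.^-cong (dir f) (gen-cong (∣∣-Glide f) (∣∣-Glide e) eq))
        (𝒜.reflexive (≡.cong (gen ∣ e ∣ (∣∣-Glide e) ^𝒜.^_) opp))))
      (^𝒜.^-opposite (gen ∣ e ∣ (∣∣-Glide e)) (dir e))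
      where
      opp : dir f ≡ opposite (dir e)
      opp = dir-opposite e f e∼f p
      ^-opp : ∀ s σ → (s ⁻¹) ^ opposite σ ≈ s ^ σ
      ^-opp s + = ⁻¹-involutive s
      ^-opp s - = refl
      eq : ∣ f ∣ ≈ ∣ e ∣
      eq = trans (∣∣≈ f) (trans (^G.^-cong (dir f) (opposite-glide e f e∼f p))
        (trans (reflexive (≡.cong ((glide e ⁻¹) ^_) opp))
        (trans (^-opp (glide e) (dir e)) (sym (∣∣≈ e)))))

    letter-slide : ∀ q → letter (bottom q) 𝒜.∙ letter (right q) 𝒜.≈ letter (left q) 𝒜.∙ letter (top q)
    letter-slide q@(basedCube A (s ∷ t ∷ []) (cubic (preCubic (ps ∷ pt ∷ []) ((st ∷ []) ∷ _)) _) v) =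
      𝒜.trans (^𝒜.^-commutes (dir b) (dir r) (gen-comm _ _
        (proj₁ indep-resp (sym (∣∣≈ r)) (proj₂ indep-resp (sym (∣∣≈ b))
          (^-Indep (dir b) (dir r) st)))))
      (𝒜.∙-cong (letter-cong r l (≡.sym (left-right q)) refl) (letter-cong b h (bottom-top q) refl))
      where
      b = bottom q
      r = right q
      l = left q
      h = top q

    word-⇝ : ∀ {A B es fs} → es ⇝ fs → Chain A es B → Chain A fs B → word es 𝒜.≈ word fs
    word-⇝ (respell []) _ _ = 𝒜.refl
    word-⇝ (respell {e ∷ es} {f ∷ fs} (r ∷ rs)) (p , c) (q , k) =
      𝒜.∙-cong (letter-cong e f (≡.sym (dir-same e f r eq)) (sym eq′))
               (word-⇝ (respell rs) c (chain-resp fs (∙-cong (sym eq′) (sym eq)) k))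
      where
      eq : base f ≈ base e
      eq = trans (sym q) p
      eq′ : glide f ≈ glide e
      eq′ = same-glide e f r eq
    word-⇝ (backtrack {e} {f} es r) (_ , p , _) _ =
      𝒜.trans (𝒜.sym (𝒜.assoc _ _ _))
      (𝒜.trans (𝒜.∙-congʳ (letter-backtrack e f r (sym p))) (𝒜.identityˡ _))
    word-⇝ (slide q es) _ _ =
      𝒜.trans (𝒜.sym (𝒜.assoc _ _ _))
      (𝒜.trans (𝒜.∙-congʳ (letter-slide q)) (𝒜.assoc _ _ _))
    word-⇝ (e ∷ m) (_ , c) (_ , k) = 𝒜.∙-congˡ (word-⇝ m c k)

    μ-cong : ∀ {A} {p q : Path A A} → p ≃ q → μ p 𝒜.≈ μ q
    μ-cong = EqClosure.gfold 𝒜.isEquivalence μ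
      (λ {p} {q} m → word-⇝ m (chain p) (chain q))

    word-++ : ∀ es fs → word (es ++ fs) 𝒜.≈ word es 𝒜.∙ word fs
    word-++ []       fs = 𝒜.sym (𝒜.identityˡ _)
    word-++ (e ∷ es) fs = 𝒜.trans (𝒜.∙-congˡ (word-++ es fs)) (𝒜.sym (𝒜.assoc _ _ _))

    μ-isGroupHomomorphism : ∀ A →
      GroupMorphisms.IsGroupHomomorphism (Group.rawGroup (π₁ A)) 𝒜.rawGroup μ
    μ-isGroupHomomorphism A = record
      { isMonoidHomomorphism = record
        { isMagmaHomomorphism = record
          { isRelHomomorphism = record { cong = μ-cong }
          ; homo = λ p q → word-++ (edges p) (edges q)
          }
        ; ε-homo = 𝒜.refl
        }
      ; ⁻¹-homo = λ p → 𝒜ᵖ.inverseˡ-unique (μ (reverse p)) (μ p)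
          (𝒜.trans (𝒜.sym (word-++ (edges (reverse p)) (edges p))) (μ-cong (·-inverseˡ p)))
      }

open Cubes public using (Bounded)
open Artin public using (artinGroup)
open GlideComplex public using (Regular; SquareCondition; Orientation; π₁)
open GlideComplex.Typing public using (μ; μ-isGroupHomomorphism)

{-# OPTIONS --safe #-}

-- A trivial word of a right-angled Artin group is reduced to the empty word by
-- exchanging neighbouring independent letters and deleting inverse pairs alone, with no
-- insertions.  This is a confluence argument in which all case distinctions concern
-- positions in the word, so equality and independence need not be decidable.  Both moves
-- lift to edge paths of X_D: a deletion is a backtrack because |e| and the direction of
-- e determine its glide, and an exchange in A → sA → tsA is a slide because the square
-- condition at sA, applied to s⁻¹ and t, puts tA in D.

module Submission where

open import Defs
open import Algebra.Bundles using (Group)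
open import Algebra.Morphism.Structures using (module GroupMorphisms)
import Algebra.Properties.Group as GroupProperties
open import Data.Bool.Base using (true; false)
open import Data.List.Base using (List; []; _∷_; _++_; map)
open import Data.List.Properties using (++-assoc; ++-identityʳ)
open import Data.List.Relation.Binary.Pointwise.Base using (Pointwise; []; _∷_)
open import Data.Product.Base using (∃; _×_; _,_; proj₁; proj₂)
open import Data.Sign.Base using (Sign; +; -; opposite)
open import Data.Sign.Properties using (opposite-involutive)
open import Data.Sum.Base using (_⊎_; inj₁; inj₂)
import Data.Sum.Base as Sum
open import Data.Vec.Base using (_∷_; [])
open import Function.Bundles using (_⇔_; mk⇔; Equivalence)
open import Function.Definitions using (Injective)
open import Function.Properties.Equivalence using (⇔-isEquivalence)
open import Level using (Level; _⊔_; suc)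
open import Relation.Binary.Core using (Rel)
open import Relation.Binary.Construct.Closure.Equivalence as EqClosure using (EqClosure)
import Relation.Binary.Construct.Closure.Reflexive as ReflClosure
open import Relation.Binary.Construct.Closure.ReflexiveTransitive as Star
  using (Star; ε; _◅_; _◅◅_)
open import Relation.Binary.Construct.Union using (_∪_)
open import Relation.Binary.Definitions using (_Respects₂_)
open import Relation.Binary.PropositionalEquality as ≡ using (_≡_)
open import Relation.Binary.Structures using (IsEquivalence)
open import Relation.Nullary using (¬_; contradiction)

-- Alphabets with formal inverses and an independence relation.

record IndependenceAlphabet (a ℓ i : Level) : Set (suc (a ⊔ ℓ ⊔ i)) where
  infix 4 _∼_ _#_
  field
    Letter          : Set a
    _∼_             : Rel Letter ℓ
    ∼-isEquivalence : IsEquivalence _∼_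
    bar             : Letter → Letter
    bar-cong        : ∀ {x y} → x ∼ y → bar x ∼ bar y
    bar-involutive  : ∀ x → bar (bar x) ∼ x
    _#_             : Rel Letter i
    #-resp          : _#_ Respects₂ _∼_
    #-sym           : ∀ {x y} → x # y → y # x
    #-bar           : ∀ {x y} → x # y → bar x # y
    #-irrefl        : ∀ {x y} → x # y → ¬ x ∼ y

-- Confluence of deletions modulo exchanges.

module Reduction {a ℓ i} (𝓛 : IndependenceAlphabet a ℓ i) where
  open IndependenceAlphabet 𝓛
  open IsEquivalence ∼-isEquivalence
    using () renaming (sym to ∼-sym; trans to ∼-trans)

  open ReflClosure using (ReflClosure; refl; [_])

  infix 4 _⇄_ _≋_

  -- The reversible moves are kept apart from deletions, so that confluence has to be shown only
  -- modulo them.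
  data _⇄_ : Rel (List Letter) (a ⊔ ℓ ⊔ i) where
    swap    : ∀ {x y w} → x # y → x ∷ y ∷ w ⇄ y ∷ x ∷ w
    respell : ∀ {x y w} → x ∼ y → x ∷ w ⇄ y ∷ w
    _∷_     : ∀ z {w v} → w ⇄ v → z ∷ w ⇄ z ∷ v

  -- Pull x w v: an occurrence of x in w can be exchanged to the front, leaving v.
  data Pull (x : Letter) : Rel (List Letter) (a ⊔ ℓ ⊔ i) where
    here  : ∀ {y w} → y ∼ x → Pull x (y ∷ w) w
    there : ∀ {z w v} → x # z → Pull x w v → Pull x (z ∷ w) (z ∷ v)

  -- The exchanges that bring the inverse letter next to `x` are built into the deletion. Overlaps
  -- of moves can then be resolved with at most one deletion on each side.
  data Cancel : Rel (List Letter) (a ⊔ ℓ ⊔ i) where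
    now : ∀ {x w v} → Pull (bar x) w v → Cancel (x ∷ w) v
    _∷_ : ∀ z {w v} → Cancel w v → Cancel (z ∷ w) (z ∷ v)

  data Null : List Letter → Set (a ⊔ ℓ ⊔ i) where
    []  : Null []
    _∷_ : ∀ {w v} → Cancel w v → Null v → Null w

  ⇄-sym : ∀ {w v} → w ⇄ v → v ⇄ w
  ⇄-sym (swap p)    = swap (#-sym p)
  ⇄-sym (respell p) = respell (∼-sym p)
  ⇄-sym (z ∷ m)     = z ∷ ⇄-sym m

  pull-resp : ∀ {x y w v} → x ∼ y → Pull x w v → Pull y w v
  pull-resp eq (here p)    = here (∼-trans p eq)
  pull-resp eq (there p q) = there (proj₂ #-resp eq p) (pull-resp eq q)

  -- Irreflexivity of independence forbids passing over a letter equivalent to `x`, so only the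
  -- first such occurrence can be pulled. This replaces a decision of equality.
  pull-unique : ∀ {x w v u} → Pull x w v → Pull x w u → v ≡ u
  pull-unique (here _)    (here _)    = ≡.refl
  pull-unique (here p)    (there q _) = contradiction (∼-sym p) (#-irrefl q)
  pull-unique (there p _) (here q)    = contradiction (∼-sym q) (#-irrefl p)
  pull-unique (there _ p) (there _ q) = ≡.cong (_ ∷_) (pull-unique p q)

  pull-front : ∀ {x w v} → Pull x w v → Star _⇄_ w (x ∷ v)
  pull-front (here p)            = respell p ◅ ε
  pull-front (there {z = z} p q) = Star.gmap (z ∷_) (z ∷_) (pull-front q) ◅◅ swap (#-sym p) ◅ ε

  -- Independent letters are inequivalent, so the two pulls take different occurrences and neither
  -- obstructs the other.
  pull-pull : ∀ {x y w v u} → x # y → Pull x w v → Pull y w u →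
    ∃ λ t → Pull y v t × Pull x u t
  pull-pull x#y (here p)    (here q)    = contradiction (∼-trans (∼-sym p) q) (#-irrefl x#y)
  pull-pull x#y (here p)    (there _ q) = _ , q , here p
  pull-pull x#y (there _ p) (here q)    = _ , here q , p
  pull-pull x#y (there a p) (there b q) with _ , p′ , q′ ← pull-pull x#y p q =
    _ , there b p′ , there a q′

  pull-⇄ : ∀ {x w w′ v} → w ⇄ w′ → Pull x w v → ∃ λ v′ → Pull x w′ v′ × ReflClosure _⇄_ v v′
  pull-⇄ (swap p)    (here q)              = _ , there (proj₂ #-resp q p) (here q) , refl
  pull-⇄ (swap p)    (there a (here q))    = _ , here q , refl
  pull-⇄ (swap p)    (there a (there b q)) = _ , there b (there a q) , [ swap p ]
  pull-⇄ (respell p) (here q)              = _ , here (∼-trans (∼-sym p) q) , refl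
  pull-⇄ (respell p) (there a q)           = _ , there (proj₁ #-resp p a) q , [ respell p ]
  pull-⇄ (z ∷ m)     (here q)              = _ , here q , [ m ]
  pull-⇄ (z ∷ m)     (there a q) with _ , q′ , r ← pull-⇄ m q =
    _ , there a q′ , ReflClosure.map (z ∷_) r

  -- A move touching a deleted letter is absorbed into the deletion; any other move survives as a
  -- single move of the results.
  cancel-⇄ : ∀ {w w′ v} → w ⇄ w′ → Cancel w v → ∃ λ v′ → Cancel w′ v′ × ReflClosure _⇄_ v v′
  cancel-⇄ (swap p) (now (here q)) =
    -- Independent neighbours are never inverse to each other.
    contradiction (∼-sym q) (#-irrefl (#-bar p))
  cancel-⇄ (swap {y = y} p) (now (there _ q)) = _ , y ∷ now q , refl
  cancel-⇄ (swap p) (x ∷ now q)    = _ , now (there (#-bar (#-sym p)) q) , refl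
  cancel-⇄ (swap {x} {y} p) (_ ∷ (_ ∷ c))  = _ , y ∷ (x ∷ c) , [ swap p ]
  cancel-⇄ (respell p) (now q)     = _ , now (pull-resp (bar-cong p) q) , refl
  cancel-⇄ (respell {y = y} p) (_ ∷ c) = _ , y ∷ c , [ respell p ]
  cancel-⇄ (z ∷ m) (now q) with _ , q′ , r ← pull-⇄ m q = _ , now q′ , r
  cancel-⇄ (z ∷ m) (_ ∷ c) with _ , c′ , r ← cancel-⇄ m c =
    _ , z ∷ c′ , ReflClosure.map (z ∷_) r

  -- In the second alternative the two moves compete for the same letter x, and their
  -- results differ in which of two occurrences of x⁻¹ survives.
  pull-cancel : ∀ {x w v u} → Pull x w v → Cancel w u →
    (∃ λ t → Pull x u t × Cancel v t) ⊎ Star _⇄_ v (bar x ∷ u)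
  pull-cancel (here p)    (now q) = inj₂ (pull-front (pull-resp (bar-cong p) q))
  pull-cancel (here p)    (_ ∷ c) = inj₁ (_ , here p , c)
  pull-cancel (there a p) (now q) with _ , q′ , p′ ← pull-pull (#-sym (#-bar (#-sym a))) p q =
    inj₁ (_ , p′ , now q′)
  pull-cancel (there {z = z} a p) (_ ∷ c) with pull-cancel p c
  ... | inj₁ (_ , p′ , c′) = inj₁ (_ , there a p′ , z ∷ c′)
  ... | inj₂ ms            =
    inj₂ (Star.gmap (z ∷_) (z ∷_) ms ◅◅ swap (#-sym (#-bar a)) ◅ ε)

  -- Local confluence: deletions of disjoint pairs commute, and deletions sharing a letter give
  -- results that differ by exchanges and respellings only.
  cancel-cancel : ∀ {w v u} → Cancel w v → Cancel w u →
    (∃ λ t → Cancel v t × Cancel u t) ⊎ Star _⇄_ u v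
  cancel-cancel (now p) (now q) = inj₂ (≡.subst (Star _⇄_ _) (pull-unique q p) ε)
  cancel-cancel (now {x} p) (_ ∷ d) with pull-cancel p d
  ... | inj₁ (_ , p′ , d′) = inj₁ (_ , d′ , now p′)
  ... | inj₂ ms            =
    -- The surviving letter comes out of `pull-cancel` as `bar (bar x)`.
    inj₂ (respell (∼-sym (bar-involutive x)) ◅ Star.reverse ⇄-sym ms)
  cancel-cancel (_ ∷ c) (now {x} q) with pull-cancel q c
  ... | inj₁ (_ , q′ , c′) = inj₁ (_ , now q′ , c′)
  ... | inj₂ ms            = inj₂ (ms ◅◅ respell (bar-involutive x) ◅ ε)
  cancel-cancel (z ∷ c) (_ ∷ d) with cancel-cancel c d
  ... | inj₁ (_ , c′ , d′) = inj₁ (_ , z ∷ c′ , z ∷ d′)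
  ... | inj₂ ms            = inj₂ (Star.gmap (z ∷_) (z ∷_) ms)

  null-⇄ : ∀ {w v} → w ⇄ v → Null w → Null v
  null-⇄ m (c ∷ n) with cancel-⇄ m c
  ... | _ , c′ , refl   = c′ ∷ n
  ... | _ , c′ , [ m′ ] = c′ ∷ null-⇄ m′ n

  null-⇄* : ∀ {w v} → Star _⇄_ w v → Null w → Null v
  null-⇄* ε        n = n
  null-⇄* (m ◅ ms) n = null-⇄* ms (null-⇄ m n)

  -- Induction on the given reduction of `w`: the extra deletion is either carried past its first
  -- step to the shorter reduction, or traded for exchanges.
  null-cancel : ∀ {w v} → Cancel w v → Null w → Null v
  null-cancel c (d ∷ n) with cancel-cancel c d
  ... | inj₁ (_ , c′ , d′) = c′ ∷ null-cancel d′ n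
  ... | inj₂ ms            = null-⇄* ms n

  _≋_ : Rel (List Letter) (a ⊔ ℓ ⊔ i)
  _≋_ = EqClosure (_⇄_ ∪ Cancel)

  -- Every generator of `_≋_` preserves nullity in both directions, so insertions cannot make
  -- further words reducible to the empty one.
  null-≋ : ∀ {w v} → w ≋ v → Null w ⇔ Null v
  null-≋ = EqClosure.gfold ⇔-isEquivalence Null λ where
    (inj₁ m) → mk⇔ (null-⇄ m) (null-⇄ (⇄-sym m))
    (inj₂ c) → mk⇔ (null-cancel c) (c ∷_)

  ⇄-++ʳ : ∀ {w v} u → w ⇄ v → w ++ u ⇄ v ++ u
  ⇄-++ʳ u (swap p)    = swap p
  ⇄-++ʳ u (respell p) = respell p
  ⇄-++ʳ u (z ∷ m)     = z ∷ ⇄-++ʳ u m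

  pull-++ʳ : ∀ {x w v} u → Pull x w v → Pull x (w ++ u) (v ++ u)
  pull-++ʳ u (here p)    = here p
  pull-++ʳ u (there a p) = there a (pull-++ʳ u p)

  cancel-++ʳ : ∀ {w v} u → Cancel w v → Cancel (w ++ u) (v ++ u)
  cancel-++ʳ u (now p) = now (pull-++ʳ u p)
  cancel-++ʳ u (z ∷ c) = z ∷ cancel-++ʳ u c

  ∷-congˡ : ∀ z {w v} → w ≋ v → z ∷ w ≋ z ∷ v
  ∷-congˡ z = EqClosure.gmap (z ∷_) (Sum.map (z ∷_) (z ∷_))

  ++-congˡ : ∀ u {w v} → w ≋ v → u ++ w ≋ u ++ v
  ++-congˡ []      eq = eq
  ++-congˡ (z ∷ u) eq = ∷-congˡ z (++-congˡ u eq)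

  ++-congʳ : ∀ u {w v} → w ≋ v → w ++ u ≋ v ++ u
  ++-congʳ u = EqClosure.gmap (_++ u) (Sum.map (⇄-++ʳ u) (cancel-++ʳ u))

  ≋-sym : ∀ {w v} → w ≋ v → v ≋ w
  ≋-sym = EqClosure.symmetric _

  ++-cong : ∀ {w w′ v v′} → w ≋ w′ → v ≋ v′ → w ++ v ≋ w′ ++ v′
  ++-cong {w′ = w′} {v} p q = ++-congʳ v p ◅◅ ++-congˡ w′ q

  ≋-reflexive : ∀ {w v} → w ≡ v → w ≋ v
  ≋-reflexive ≡.refl = ε

  ≋-respell : ∀ {x y} → x ∼ y → x ∷ [] ≋ y ∷ []
  ≋-respell p = EqClosure.return (inj₁ (respell p))

  ≋-swap : ∀ {x y} → x # y → x ∷ y ∷ [] ≋ y ∷ x ∷ []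
  ≋-swap p = EqClosure.return (inj₁ (swap p))

  ≋-cancel : ∀ {x y} → y ∼ bar x → x ∷ y ∷ [] ≋ []
  ≋-cancel p = EqClosure.return (inj₂ (now (here p)))

-- From equality in the Artin group to reduction of words.

module ArtinWords {c ℓ g i} {G : Group c ℓ} (𝒮 : GlidingSystem G g i) where
  private module G = Group G
  open GlidingSystem 𝒮
  open Cubes 𝒮 using (indep⇒≉)
  open Artin 𝒮

  -- (s , σ) stands for g_s ^ σ.
  alphabet : IndependenceAlphabet c ℓ i
  alphabet = record
    { Letter          = G.Carrier × Sign
    ; _∼_             = λ { (s , σ) (t , τ) → s G.≈ t × σ ≡ τ }
    ; ∼-isEquivalence = record
      { refl  = G.refl , ≡.refl
      ; sym   = λ { (p , q) → G.sym p , ≡.sym q }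
      ; trans = λ { (p , q) (p′ , q′) → G.trans p p′ , ≡.trans q q′ }
      }
    ; bar             = λ { (s , σ) → s , opposite σ }
    ; bar-cong        = λ { (p , q) → p , ≡.cong opposite q }
    ; bar-involutive  = λ { (_ , σ) → G.refl , opposite-involutive σ }
    ; _#_             = λ { (s , _) (t , _) → Indep s t }
    ; #-resp          = (λ { (p , _) → proj₁ indep-resp p }) , (λ { (p , _) → proj₂ indep-resp p })
    ; #-sym           = indep-sym
    ; #-bar           = λ p → p
    ; #-irrefl        = λ { p (q , _) → indep⇒≉ p q }
    }

  open IndependenceAlphabet alphabet using (Letter)
  open Reduction alphabet

  -- The sign tells whether the word or its inverse is spelled; inversion is pushed down to the
  -- generators.
  spell : Word → Sign → List Letter
  spell (gen s _) σ = (s , σ) ∷ []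
  spell ε         σ = []
  spell (x ∙ y)   + = spell x + ++ spell y +
  spell (x ∙ y)   - = spell y - ++ spell x -
  spell (x ⁻¹)    σ = spell x (opposite σ)

  ++-cancel-middle : ∀ {w v v′ w′} → w ++ w′ ≋ [] → v ++ v′ ≋ [] → (w ++ v) ++ v′ ++ w′ ≋ []
  ++-cancel-middle {w} {v} {v′} {w′} p q =
    ≋-reflexive (≡.trans (++-assoc w v (v′ ++ w′)) (≡.cong (w ++_) (≡.sym (++-assoc v v′ w′))))
    ◅◅ ++-congˡ w (++-congʳ w′ q) ◅◅ p

  spell-inverse : ∀ x σ → spell x σ ++ spell x (opposite σ) ≋ []
  spell-inverse (gen s _) σ = ≋-cancel (G.refl , ≡.refl)
  spell-inverse ε         σ = ε
  spell-inverse (x ∙ y)   + = ++-cancel-middle {spell x +} (spell-inverse x +) (spell-inverse y +)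
  spell-inverse (x ∙ y)   - = ++-cancel-middle {spell y - } (spell-inverse y -) (spell-inverse x -)
  spell-inverse (x ⁻¹)    σ = spell-inverse x (opposite σ)

  -- Both signs are treated together because `⁻¹-cong` calls for the opposite one.
  spell-cong : ∀ {x y} → x ≈ y → ∀ σ → spell x σ ≋ spell y σ
  spell-cong refl          σ = ε
  spell-cong (sym p)       σ = ≋-sym (spell-cong p σ)
  spell-cong (trans p q)   σ = spell-cong p σ ◅◅ spell-cong q σ
  spell-cong (∙-cong p q)  + = ++-cong (spell-cong p +) (spell-cong q +)
  spell-cong (∙-cong p q)  - = ++-cong (spell-cong q -) (spell-cong p -)
  spell-cong (⁻¹-cong p)   σ = spell-cong p (opposite σ)
  spell-cong (assoc x y z) + = ≋-reflexive (++-assoc (spell x +) (spell y +) (spell z +))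
  spell-cong (assoc x y z) - = ≋-reflexive (≡.sym (++-assoc (spell z -) (spell y -) (spell x -)))
  spell-cong (identityˡ x) + = ε
  spell-cong (identityˡ x) - = ≋-reflexive (++-identityʳ (spell x -))
  spell-cong (identityʳ x) + = ≋-reflexive (++-identityʳ (spell x +))
  spell-cong (identityʳ x) - = ε
  spell-cong (inverseˡ x)  + = spell-inverse x -
  spell-cong (inverseˡ x)  - = spell-inverse x -
  spell-cong (inverseʳ x)  + = spell-inverse x +
  spell-cong (inverseʳ x)  - = spell-inverse x +
  spell-cong (gen-cong _ _ p) σ = ≋-respell (p , ≡.refl)
  spell-cong (gen-comm _ _ p) + = ≋-swap p
  spell-cong (gen-comm _ _ p) - = ≋-swap (indep-sym p)

  trivial⇒null : ∀ {x} → x ≈ ε → Null (spell x +)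
  trivial⇒null p = Equivalence.from (null-≋ (spell-cong p +)) []

-- Lifting reductions of words to homotopies of edge paths.

module PathLifting {c ℓ g i d} {G : Group c ℓ} (𝒮 : GlidingSystem G g i) (𝒟 : SubsetOf G d)
  (square : SquareCondition 𝒮 𝒟) (o : Orientation 𝒮 𝒟) where
  open Group G
  open GroupProperties G using (\\-leftDividesʳ; ⁻¹-involutive)
  open GlidingSystem 𝒮
  open SubsetOf 𝒟 renaming (Member to D; resp to D-resp)
  open Cubes 𝒮 using (cubic₂; prod)
  open SignedPower G using (_^_; ^-cong)
  open GlideComplex 𝒮 𝒟 hiding (Regular; SquareCondition; Orientation; π₁; module Typing)
  open GlideComplex.Typing 𝒮 𝒟 o using (∣_∣; ∣∣≈; ^-Indep; word; letter)
  open GlideComplex.Orientation o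
  private module 𝒜 = Group (artinGroup 𝒮)
  open ArtinWords 𝒮
  open IndependenceAlphabet alphabet using (Letter; bar; _#_)
    renaming (_∼_ to _∼ᴸ_; ∼-isEquivalence to ∼ᴸ-isEquivalence)
  open Reduction alphabet using (Pull; Cancel; Null; here; there; now; []; _∷_)

  label : BasedCube 1 → Letter
  label e = ∣ e ∣ , dir e

  spell-word : ∀ es → spell (word es) + ≡ map label es
  spell-word []       = ≡.refl
  spell-word (e ∷ es) = ≡.cong₂ _++_ (spell-letter e) (spell-word es)
    where
    spell-letter : ∀ e → spell (letter e) + ≡ label e ∷ []
    spell-letter e with dir e
    ... | + = ≡.refl
    ... | - = ≡.refl

  ^-^ : ∀ s σ → (s ^ σ) ^ σ ≈ s
  ^-^ s + = refl
  ^-^ s - = ⁻¹-involutive s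

  ^-opposite-⁻¹ : ∀ s σ → s ^ opposite σ ≈ (s ^ σ) ⁻¹
  ^-opposite-⁻¹ s + = refl
  ^-opposite-⁻¹ s - = sym (⁻¹-involutive s)

  -- By `∣∣≈`, the type of an edge is its glide raised to its sign, and raising to the same sign
  -- twice changes nothing.
  glide≈ : ∀ e {s σ} → label e ∼ᴸ (s , σ) → glide e ≈ s ^ σ
  glide≈ e (p , ≡.refl) =
    trans (sym (^-^ (glide e) (dir e))) (^-cong (dir e) (trans (sym (∣∣≈ e)) p))

  label-cong : ∀ e f → glide e ≈ glide f → dir e ≡ dir f → label e ∼ᴸ label f
  label-cong e f p q =
    trans (∣∣≈ e) (trans (^-cong (dir e) p)
      (trans (reflexive (≡.cong (glide f ^_) q)) (sym (∣∣≈ f)))) , q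

  indep-glides : ∀ e f {x y} → label e ∼ᴸ x → label f ∼ᴸ y → x # y → Indep (glide e) (glide f)
  indep-glides e f {_ , σ} {_ , τ} p q x#y =
    proj₁ indep-resp (sym (glide≈ f q)) (proj₂ indep-resp (sym (glide≈ e p)) (^-Indep σ τ x#y))

  glide-bar : ∀ e f {x} → label e ∼ᴸ x → label f ∼ᴸ bar x → glide f ≈ glide e ⁻¹
  glide-bar e f {s , σ} p q =
    trans (glide≈ f q) (trans (^-opposite-⁻¹ s σ) (⁻¹-cong (sym (glide≈ e p))))

  indepSquare : ∀ e f → base f ≈ end e → Indep (glide e) (glide f) → BasedCube 2
  indepSquare e f eq ind = basedCube A (s ∷ t ∷ []) (cubic₂ ind) corner
    where
    A = base e
    s = glide e
    t = glide f
    ts∈D : D (t ∙ (s ∙ A))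
    ts∈D = D-resp (∙-congˡ eq) (end∈D f)
    t∈D : D (t ∙ A)
    -- The square condition yields the vertex `s ⁻¹ ∙ t ∙ (s ∙ A)`, which is `t ∙ A` because the
    -- glides commute.
    t∈D = D-resp (trans (assoc (s ⁻¹) t (s ∙ A))
                 (trans (∙-congˡ (trans (sym (assoc t s A))
                          (trans (∙-congʳ (sym (indep-comm ind))) (assoc s t A))))
                        (\\-leftDividesʳ s (t ∙ A))))
      (square (s ∙ A) (s ⁻¹) t (end∈D e) (indep-⁻¹ ind)
        (D-resp (sym (\\-leftDividesʳ s A)) (base∈D e)) ts∈D)
    corner : ∀ T → D (prod T (s ∷ t ∷ []) ∙ A)
    corner (true  ∷ true  ∷ []) =
      D-resp (trans (sym (assoc t s A))
        (∙-congʳ (trans (sym (indep-comm ind)) (∙-congˡ (sym (identityʳ t)))))) ts∈D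
    corner (true  ∷ false ∷ []) = D-resp (∙-congʳ (sym (identityʳ s))) (end∈D e)
    corner (false ∷ true  ∷ []) = D-resp (∙-congʳ (sym (identityʳ t))) t∈D
    corner (false ∷ false ∷ []) = D-resp (sym (identityˡ A)) (base∈D e)

  -- Equivalence of letters rather than equality, since a slide preserves labels only up to `_≈_` of
  -- glides.
  Spells : List (BasedCube 1) → List Letter → Set _
  Spells = Pointwise (λ e x → label e ∼ᴸ x)

  consPath : ∀ {A B} e → A ≈ base e → Path (end e) B → Path A B
  consPath e a p = path (e ∷ edges p) (a , chain p)

  consPath-cong : ∀ {A B} e (a : A ≈ base e) {p q : Path (end e) B} →
    p ≃ q → consPath e a p ≃ consPath e a q
  consPath-cong e a = EqClosure.gmap (consPath e a) (e ∷_)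

  -- The counterpart of `Pull` for paths, with the exchanges realised by a homotopy with fixed
  -- endpoints.
  record Pulled {A B} (p : Path A B) (x : Letter) (v : List Letter) : Set (c ⊔ ℓ ⊔ g ⊔ i ⊔ d) where
    constructor pulled
    field
      first    : BasedCube 1
      starts   : A ≈ base first
      rest     : Path (end first) B
      homotopy : p ≃ consPath first starts rest
      reads    : label first ∼ᴸ x
      spells   : Spells (edges rest) v

  -- An orientation directs opposite sides of a square alike, so the slide exchanges the two labels
  -- without altering them.
  pulled-swap : ∀ {A B} e (a : A ≈ base e) f (b : end e ≈ base f) (r : Path (end f) B) {x z v} →
    label e ∼ᴸ z → label f ∼ᴸ x → x # z → Spells (edges r) v →
    Pulled (consPath e a (consPath f b r)) x (z ∷ v)
  pulled-swap {A} {B} e a f b r e∼z f∼x x#z sp =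
    pulled (left q) a (path (top q ∷ edges r) (refl , chain-resp (edges r) end-top (chain r)))
      -- The sides of `q` are other representatives of the cells of `e` and `f`, so the path is
      -- respelled before the slide.
      (≃-trans (move {q = via} (respell (∼-same e (bottom q) refl refl
                                        ∷ ∼-same f (right q) b refl
                                        ∷ respell-refl (edges r))))
               (move (slide q (edges r))))
      (trans∼ (label-cong (left q) f refl
                (≡.trans (left-right q) (dir-same f (right q) (∼-same f (right q) b refl) b)))
              f∼x)
      (trans∼ (label-cong (top q) e refl
                (≡.trans (≡.sym (bottom-top q))
                  (dir-same e (bottom q) (∼-same e (bottom q) refl refl) refl)))
              e∼z ∷ sp)
    where
    open IsEquivalence ∼ᴸ-isEquivalence using () renaming (trans to trans∼)
    ind : Indep (glide e) (glide f)
    ind = indep-glides e f e∼z f∼x (indep-sym x#z)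
    q : BasedCube 2
    q = indepSquare e f (sym b) ind
    end-right : end (right q) ≈ end f
    end-right = ∙-congˡ b
    end-top : end (top q) ≈ end f
    end-top = trans (sym (assoc _ _ _)) (trans (∙-congʳ (indep-comm ind)) (trans (assoc _ _ _) end-right))
    via : Path A B
    via = path (bottom q ∷ right q ∷ edges r) (a , refl , chain-resp (edges r) end-right (chain r))

  lift-pull : ∀ {A B x w v} (p : Path A B) → Spells (edges p) w → Pull x w v → Pulled p x v
  lift-pull (path (e ∷ es) (a , c)) (eq ∷ sp) (here p) =
    pulled e a (path es c) ≃-refl (IsEquivalence.trans ∼ᴸ-isEquivalence eq p) sp
  lift-pull (path (e ∷ es) (a , c)) (eq ∷ sp) (there x#z q)
    with pulled f b r h f∼x sp′ ← lift-pull (path es c) sp q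
    -- The edge reading `x` now comes right after `e`; one slide takes it past `e`.
    with pulled f′ b′ r′ h′ f′∼x sp″ ← pulled-swap e a f b r eq f∼x x#z sp′ =
    pulled f′ b′ r′ (≃-trans (consPath-cong e a h) h′) f′∼x sp″

  lift-cancel : ∀ {A B w v} (p : Path A B) → Spells (edges p) w → Cancel w v →
    ∃ λ (q : Path A B) → p ≃ q × Spells (edges q) v
  lift-cancel (path (e ∷ es) (a , c)) (eq ∷ sp) (now q)
    with pulled f b r h f∼x sp′ ← lift-pull (path es c) sp q =
    path (edges r) (chain-resp (edges r) A≈end (chain r)) ,
    ≃-trans (consPath-cong e a h) (move (backtrack (edges r) (∼-opposite e f (sym b) inv))) , sp′
    where
    inv : glide f ≈ glide e ⁻¹
    inv = glide-bar e f eq f∼x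
    -- Inverse glides make `f` return to the start of `e`, so the remaining path again begins at
    -- `A`.
    A≈end : _ ≈ end f
    A≈end = trans a (sym (opposite-end e (sym b) inv))
  lift-cancel (path (e ∷ es) (a , c)) (eq ∷ sp) (_ ∷ d)
    with r , h , sp′ ← lift-cancel (path es c) sp d =
    consPath e a r , consPath-cong e a h , eq ∷ sp′

  null⇒≃nil : ∀ {A w} (p : Path A A) → Spells (edges p) w → Null w → p ≃ nil
  null⇒≃nil (path [] c) []  []      = edges≡ (path [] c) nil ≡.refl
  null⇒≃nil p           sp  (c ∷ n) with q , h , sp′ ← lift-cancel p sp c =
    ≃-trans h (null⇒≃nil q sp′ n)

  spells-labels : ∀ es → Spells es (map label es)
  spells-labels []       = []
  spells-labels (e ∷ es) = (refl , ≡.refl) ∷ spells-labels es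

  trivial-word⇒≃nil : ∀ {A} (p : Path A A) → μ 𝒮 𝒟 o p 𝒜.≈ 𝒜.ε → p ≃ nil
  trivial-word⇒≃nil p eq = null⇒≃nil p (spells-labels (edges p))
    (≡.subst Null (spell-word (edges p)) (trivial⇒null eq))

theorem5p3 : ∀ {c ℓ g i d} (G : Group c ℓ) (𝒮 : GlidingSystem G g i) → Bounded 𝒮 →
    (𝒟 : SubsetOf G d) → Regular 𝒮 𝒟 → SquareCondition 𝒮 𝒟 → (o : Orientation 𝒮 𝒟) →
    ∀ A → SubsetOf.Member 𝒟 A →
    Injective (Group._≈_ (π₁ 𝒮 𝒟 A)) (Group._≈_ (artinGroup 𝒮)) (μ 𝒮 𝒟 o)
theorem5p3 G 𝒮 _ 𝒟 _ square o A _ {p} {q} μp≈μq =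
  -- Triviality of the kernel suffices, applied to the loop `p · reverse q`.
  GroupProperties.x∙y⁻¹≈ε⇒x≈y (π₁ 𝒮 𝒟 A) p q
    (PathLifting.trivial-word⇒≃nil 𝒮 𝒟 square o (p · reverse q)
      (𝒜.trans (homo p (reverse q))
      (𝒜.trans (𝒜.∙-congˡ (⁻¹-homo q))
               (GroupProperties.x≈y⇒x∙y⁻¹≈ε (artinGroup 𝒮) μp≈μq))))
  where
  module 𝒜 = Group (artinGroup 𝒮)
  open GlideComplex 𝒮 𝒟 using (_·_; reverse)
  open GroupMorphisms.IsGroupHomomorphism (μ-isGroupHomomorphism 𝒮 𝒟 o A) using (homo; ⁻¹-homo)
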